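{- For all $n\geq3$ and $k\geq3$, the $3$-restricted edge-connectivity of the DCell satisfies $\lambda_3(D_{k,n})=3n+3k-9$.
   Context: DCell $D_{k,n}$ ($n\geq 2$, $k\geq 0$) is defined recursively. $D_{0,n}$ is the complete graph $K_n$ on vertices $0,1,\dots,n-1$. Let $t_{k,n}=|V(D_{k,n})|$. For $k\geq1$, $D_{k,n}$ is built from $t_{k-1,n}+1$ disjoint copies $D^0_{k-1,n},\dots,D^{t_{k-1,n}}_{k-1,n}$ of $D_{k-1,n}$; a vertex of copy $D^i_{k-1,n}$ is labeled $(i,a_{k-1},\dots,a_0)$, where $(a_{k-1},\dots,a_0)$ is its label in $D_{k-1,n}$, and its index within the copy is $uid_{k-1}=a_0+\sum_{l=1}^{k-1}a_l t_{l-1,n}$. For each pair $a<b$ of copy indices, one edge joins the vertex of $D^a_{k-1,n}$ with $uid_{k-1}=b-1$ to the vertex of $D^b_{k-1,n}$ with $uid_{k-1}=a$. An edge set $F$ is a $3$-restricted edge-cut of $G$ if $G-F$ is disconnected and every component of $G-F$ has at least $3$ vertices; $\lambda_3(G)$ is the minimum size of such a cut. -}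

module Defs where

open import Data.Nat using (ℕ; zero; suc; _+_; _*_; _∸_; _<_; _≤_)
open import Data.Fin using (Fin; toℕ)
open import Data.Product using (_×_; _,_; ∃; ∃-syntax)
open import Data.Sum using (_⊎_)
open import Data.List using (List; length)
open import Data.List.Membership.Propositional using (_∈_)
open import Data.List.Relation.Unary.AllPairs using (AllPairs)
open import Relation.Binary.PropositionalEquality using (_≡_; _≢_)
open import Relation.Nullary using (¬_)

-- t k n = |V(D_{k,n})|
t : ℕ → ℕ → ℕ
t zero    n = n
t (suc k) n = suc (t k n) * t k n

-- Vertices of D_{k,n}, as labels: D_{0,n} has vertices 0..n-1;
-- a vertex of D_{k+1,n} is (i , label in D_{k,n}) with copy index i ≤ t k n.
Vertex : ℕ → ℕ → Set
Vertex zero    n = Fin n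
Vertex (suc k) n = Fin (suc (t k n)) × Vertex k n

uid : (k n : ℕ) → Vertex k n → ℕ
uid zero    n x       = toℕ x
uid (suc k) n (i , u) = toℕ i * t k n + uid k n u

Adj : (k n : ℕ) → Vertex k n → Vertex k n → Set
Adj zero    n x y = x ≢ y
Adj (suc k) n (i , u) (j , w) =
    (i ≡ j × Adj k n u w)
  ⊎ ((toℕ i < toℕ j × uid k n u ≡ toℕ j ∸ 1 × uid k n w ≡ toℕ i)
  ⊎  (toℕ j < toℕ i × uid k n w ≡ toℕ i ∸ 1 × uid k n u ≡ toℕ j))

record Graph : Set₁ where
  field
    V   : Set
    E   : V → V → Set

open Graph public

DCell : ℕ → ℕ → Graph
DCell k n = record { V = Vertex k n ; E = Adj k n }

module _ (G : Graph) where

  -- an edge given by an (ordered) pair of endpoints; two pairs denote the same edge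
  SameEdge : V G × V G → V G × V G → Set
  SameEdge (a , b) (c , d) = (a ≡ c × b ≡ d) ⊎ (a ≡ d × b ≡ c)

  record EdgeSet : Set where
    field
      edges    : List (V G × V G)
      areEdges : ∀ {a b} → (a , b) ∈ edges → E G a b
      distinct : AllPairs (λ e f → ¬ SameEdge e f) edges

  open EdgeSet public

  size : EdgeSet → ℕ
  size F = length (edges F)

  AdjMinus : EdgeSet → V G → V G → Set
  AdjMinus F u v = E G u v × ¬ ((u , v) ∈ edges F) × ¬ ((v , u) ∈ edges F)

  data Reach (F : EdgeSet) (u : V G) : V G → Set where
    here : Reach F u u
    step : ∀ {v w} → Reach F u v → AdjMinus F v w → Reach F u w

  -- F is a 3-restricted edge-cut: G - F is disconnected and every component
  -- (the set of vertices reachable from some vertex) has at least 3 vertices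
  Is3RestrictedCut : EdgeSet → Set
  Is3RestrictedCut F =
      (∃[ u ] ∃[ v ] ¬ Reach F u v)
    × (∀ v → ∃[ x ] ∃[ y ] (Reach F v x × Reach F v y × x ≢ y × x ≢ v × y ≢ v))

  Lambda3≡ : ℕ → Set
  Lambda3≡ m =
      (∃[ F ] (Is3RestrictedCut F × size F ≡ m))
    × (∀ F → Is3RestrictedCut F → m ≤ size F)

{-# OPTIONS --safe #-}

-- Lower bound.  Let ∂X be the number of edges leaving a vertex set X.  By induction on k, for
-- j ∈ {1,2,3}, a ≥ 1, k + a ≥ j and |X| ≥ j one has ∂X + a|X| ≥ j(n + k + a − j): the left side is
-- the boundary of X seen in D_{k+a,n}, and the right side is that of j vertices of one K_n.
-- If X meets a single copy of D_{k-1,n}, each of its vertices has its top level edge cut, and the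
-- claim for a + 1 applies; if X meets several copies, the bounds for smaller j add up to more
-- than is needed.  For a cut of the whole graph, either some copy is full and another one is
-- empty, which forces t_{k-1,n} cut edges, or after complementation no copy is full; then three
-- nonempty copies contribute their edge-connectivity, and one or two of them are handled by the
-- bound with a = 1.  Upper bound: the edges leaving a triangle of one K_n.
module Submission where

open import Defs
open import Data.Bool using (Bool; true; false; not; if_then_else_)
open import Data.Bool.Properties using (not-involutive)
open import Data.Fin as Fin using (Fin; zero; suc; toℕ; punchIn; punchOut; combine; remQuot; _↑ˡ_; _↑ʳ_)
open import Data.Fin.Properties as Finₚ
  using (punchInᵢ≢i; punchIn-punchOut; punchOut-punchIn; punchOut-injective; punchOut-cong; any?)
open import Data.List using (List; []; _∷_; _++_; length; map; tabulate; cartesianProduct)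
open import Data.List.Membership.Propositional using (_∈_)
open import Data.List.Membership.Propositional.Properties
  using (∈-++⁺ˡ; ∈-++⁺ʳ; ∈-++⁻; ∈-map⁺; ∈-map⁻; ∈-tabulate⁺; ∈-tabulate⁻; ∈-cartesianProduct⁺; ∈-cartesianProduct⁻)
open import Data.List.Properties using (length-map; length-++; length-tabulate)
open import Data.List.Relation.Unary.All as All using (All; []; _∷_)
open import Data.List.Relation.Unary.AllPairs using (AllPairs; []; _∷_)
open import Data.List.Relation.Unary.Any using (here; there)
open import Data.List.Relation.Unary.Unique.Propositional using (Unique)
import Data.List.Relation.Unary.Unique.Propositional.Properties as Uniqueₚ
open import Data.Nat using (ℕ; zero; suc; _+_; _*_; _∸_; _≤_; _<_; z≤n; s≤s; s≤s⁻¹; z<s; _≤?_)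
open import Data.Nat.Properties
open import Data.Nat.Tactic.RingSolver using (solve-∀)
open import Data.Product using (_×_; _,_; ∃; ∃-syntax; proj₁; proj₂; map₂)
open import Data.Product.Properties using (≡-dec)
open import Data.Sum using (_⊎_; inj₁; inj₂)
open import Function using (_∘_)
open import Relation.Binary.Definitions using (DecidableEquality; tri<; tri≈; tri>)
open import Relation.Binary.PropositionalEquality
open import Relation.Nullary using (¬_; Dec; yes; no; does; contradiction)
open import Relation.Nullary.Decidable
  using (_×-dec_; _⊎-dec_; ¬?; decidable-stable; ¬¬-excluded-middle; dec-true; dec-false)
open import Relation.Nullary.Negation using (¬¬-map)
open import Algebra.Properties.Semiring.Sum +-*-semiring
  using (sum; sum-remove; sum-cong-≗; ∑-distrib-+; ∑-comm; *-distribˡ-sum; *-distribʳ-sum)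

private variable
  m n k : ℕ

-- Finite sums of natural numbers and indicator values.

sum-mono : {f g : Fin m → ℕ} → (∀ i → f i ≤ g i) → sum f ≤ sum g
sum-mono {zero}  f≤g = z≤n
sum-mono {suc _} f≤g = +-mono-≤ (f≤g zero) (sum-mono (f≤g ∘ suc))

sum-zero : {f : Fin m → ℕ} → (∀ i → f i ≡ 0) → sum f ≡ 0
sum-zero {zero}  f≡0 = refl
sum-zero {suc _} f≡0 = cong₂ _+_ (f≡0 zero) (sum-zero (f≡0 ∘ suc))

sum-≥-count : {f : Fin m → ℕ} → (∀ i → 1 ≤ f i) → m ≤ sum f
sum-≥-count {zero}  1≤f = z≤n
sum-≥-count {suc _} 1≤f = +-mono-≤ (1≤f zero) (sum-≥-count (1≤f ∘ suc))

term≤sum : (f : Fin m → ℕ) (i : Fin m) → f i ≤ sum f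
term≤sum {suc _} f i = ≤-trans (m≤m+n _ _) (≤-reflexive (sym (sum-remove {i = i} f)))

two-terms≤sum : (f : Fin m → ℕ) {i j : Fin m} → i ≢ j → f i + f j ≤ sum f
two-terms≤sum {suc _} f {i} {j} i≢j = begin
  f i + f j                             ≡⟨ cong (λ l → f i + f l) (punchIn-punchOut i≢j) ⟨
  f i + f (punchIn i (punchOut i≢j))    ≤⟨ +-monoʳ-≤ (f i) (term≤sum (f ∘ punchIn i) (punchOut i≢j)) ⟩
  f i + sum (f ∘ punchIn i)             ≡⟨ sum-remove {i = i} f ⟨
  sum f                                 ∎
  where open ≤-Reasoning

three-terms≤sum : (f : Fin m → ℕ) {i j l : Fin m} → i ≢ j → i ≢ l → j ≢ l → f i + (f j + f l) ≤ sum f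
three-terms≤sum {suc _} f {i} {j} {l} i≢j i≢l j≢l = begin
  f i + (f j + f l)
    ≡⟨ cong₂ (λ a b → f i + (f a + f b)) (punchIn-punchOut i≢j) (punchIn-punchOut i≢l) ⟨
  f i + (f (punchIn i (punchOut i≢j)) + f (punchIn i (punchOut i≢l)))
    ≤⟨ +-monoʳ-≤ (f i) (two-terms≤sum (f ∘ punchIn i) (j≢l ∘ punchOut-injective i≢j i≢l)) ⟩
  f i + sum (f ∘ punchIn i)
    ≡⟨ sum-remove {i = i} f ⟨
  sum f ∎
  where open ≤-Reasoning

sum≤term : (f : Fin m → ℕ) (i : Fin m) → (∀ j → j ≢ i → f j ≡ 0) → sum f ≤ f i
sum≤term {suc _} f i f≡0 = begin
  sum f                       ≡⟨ sum-remove {i = i} f ⟩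
  f i + sum (f ∘ punchIn i)   ≡⟨ cong (f i +_) (sum-zero (λ p → f≡0 _ (punchInᵢ≢i i p))) ⟩
  f i + 0                     ≡⟨ +-identityʳ _ ⟩
  f i                         ∎
  where open ≤-Reasoning

sum≤two-terms : (f : Fin m → ℕ) {i j : Fin m} → i ≢ j →
                (∀ l → l ≢ i → l ≢ j → f l ≡ 0) → sum f ≤ f i + f j
sum≤two-terms {suc _} f {i} {j} i≢j f≡0 = begin
  sum f                                ≡⟨ sum-remove {i = i} f ⟩
  f i + sum (f ∘ punchIn i)            ≤⟨ +-monoʳ-≤ (f i) (sum≤term (f ∘ punchIn i) (punchOut i≢j) rest) ⟩
  f i + f (punchIn i (punchOut i≢j))   ≡⟨ cong (λ l → f i + f l) (punchIn-punchOut i≢j) ⟩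
  f i + f j                            ∎
  where
  open ≤-Reasoning
  rest : ∀ p → p ≢ punchOut i≢j → f (punchIn i p) ≡ 0
  rest p p≢ = f≡0 _ (punchInᵢ≢i i p)
    λ eq → p≢ (trans (sym (punchOut-punchIn i)) (punchOut-cong i eq))

-- Applied to the numbers of chosen vertices in the copies. Three witnesses suffice because at most
-- three nonempty copies are ever counted separately. `one` leaves the size of `f i` open; the lower
-- bound on the whole set supplies it.
data Support {m : ℕ} (f : Fin m → ℕ) : Set where
  none  : (∀ i → f i ≡ 0) → Support f
  one   : ∀ i → (∀ j → j ≢ i → f j ≡ 0) → Support f
  two   : ∀ i j → i ≢ j → 1 ≤ f i → 1 ≤ f j → (∀ l → l ≢ i → l ≢ j → f l ≡ 0) → Support f
  three : ∀ i j l → i ≢ j → i ≢ l → j ≢ l → 1 ≤ f i → 1 ≤ f j → 1 ≤ f l → Support f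

¬1≤⇒≡0 : ∀ {x} → ¬ 1 ≤ x → x ≡ 0
¬1≤⇒≡0 {zero}  _  = refl
¬1≤⇒≡0 {suc _} ≰ = contradiction z<s ≰

support : (f : Fin m → ℕ) → Support f
support f with any? (λ i → 1 ≤? f i)
... | no ¬i = none λ i → ¬1≤⇒≡0 (λ p → ¬i (i , p))
... | yes (i , fi) with any? (λ j → ¬? (j Fin.≟ i) ×-dec (1 ≤? f j))
... | no ¬j = one i λ j j≢i → ¬1≤⇒≡0 (λ p → ¬j (j , j≢i , p))
... | yes (j , j≢i , fj) with any? (λ l → ¬? (l Fin.≟ i) ×-dec ¬? (l Fin.≟ j) ×-dec (1 ≤? f l))
... | no ¬l = two i j (j≢i ∘ sym) fi fj λ l l≢i l≢j → ¬1≤⇒≡0 (λ p → ¬l (l , l≢i , l≢j , p))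
... | yes (l , l≢i , l≢j , fl) = three i j l (j≢i ∘ sym) (l≢i ∘ sym) (l≢j ∘ sym) fi fj fl

∑-splitAt : ∀ m {l} (f : Fin (m + l) → ℕ) → sum f ≡ sum (f ∘ (_↑ˡ l)) + sum (f ∘ (m ↑ʳ_))
∑-splitAt zero    f = refl
∑-splitAt (suc m) f = trans (cong (f zero +_) (∑-splitAt m (f ∘ suc))) (sym (+-assoc (f zero) _ _))

∑-combine : ∀ m l (f : Fin (m * l) → ℕ) → sum f ≡ sum (λ i → sum (λ j → f (combine {m} {l} i j)))
∑-combine zero    l f = refl
∑-combine (suc m) l f =
  trans (∑-splitAt l f) (cong (sum (f ∘ (_↑ˡ (m * l))) +_) (∑-combine m l (f ∘ (l ↑ʳ_))))

sum-*-sum : ∀ {m l} (f : Fin m → ℕ) (g : Fin l → ℕ) →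
            sum f * sum g ≡ sum (λ i → sum (λ j → f i * g j))
sum-*-sum f g = trans (*-distribʳ-sum (sum g) f) (sum-cong-≗ (λ i → *-distribˡ-sum (f i) g))

⟦_⟧ : Bool → ℕ
⟦ true ⟧  = 1
⟦ false ⟧ = 0

⟦⟧≤1 : ∀ b → ⟦ b ⟧ ≤ 1
⟦⟧≤1 true  = ≤-refl
⟦⟧≤1 false = z≤n

⟦⟧+⟦not⟧ : ∀ b → ⟦ b ⟧ + ⟦ not b ⟧ ≡ 1
⟦⟧+⟦not⟧ true  = refl
⟦⟧+⟦not⟧ false = refl

⟦⟧≡0 : ∀ b → ⟦ b ⟧ ≡ 0 → b ≡ false
⟦⟧≡0 false refl = refl

not≡false : ∀ b → not b ≡ false → b ≡ true
not≡false true refl = refl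

-- Enumeration of the vertices and sums over them.

-- The order is lexicographic with the copy index most significant, so the position of a vertex
-- equals its `uid`. Positions thus serve both as summation indices and as the numbers in the wiring
-- rule.
decode : ∀ k → Fin (t k n) → Vertex k n
decode zero            p = p
decode {n = n} (suc k) p = map₂ (decode k) (remQuot (t k n) p)

encode : ∀ k → Vertex k n → Fin (t k n)
encode zero    x       = x
encode (suc k) (i , u) = combine i (encode k u)

decode-combine : ∀ k (i : Fin (suc (t k n))) p → decode (suc k) (combine i p) ≡ (i , decode k p)
decode-combine k i p = cong (map₂ (decode k)) (Finₚ.remQuot-combine i p)

decode-encode : ∀ k (v : Vertex k n) → decode k (encode k v) ≡ v
decode-encode zero    x       = refl
decode-encode (suc k) (i , u) = trans (decode-combine k i _) (cong (i ,_) (decode-encode k u))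

encode-decode : ∀ k (p : Fin (t k n)) → encode k (decode k p) ≡ p
encode-decode zero            p = refl
encode-decode {n = n} (suc k) p =
  trans (cong (combine (proj₁ q)) (encode-decode k (proj₂ q)))
        (Finₚ.combine-remQuot {suc (t k n)} (t k n) p)
  where q = remQuot {suc (t k n)} (t k n) p

uid≡toℕ-encode : ∀ k (v : Vertex k n) → uid k n v ≡ toℕ (encode k v)
uid≡toℕ-encode zero    x       = refl
uid≡toℕ-encode {n = n} (suc k) (i , u) = begin
  toℕ i * t k n + uid k n u              ≡⟨ cong₂ _+_ (*-comm (toℕ i) _) (uid≡toℕ-encode k u) ⟩
  t k n * toℕ i + toℕ (encode k u)       ≡⟨ Finₚ.toℕ-combine i (encode k u) ⟨
  toℕ (combine i (encode k u))           ∎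
  where open ≡-Reasoning

uid-decode : ∀ k (p : Fin (t k n)) → uid k n (decode k p) ≡ toℕ p
uid-decode k p = trans (uid≡toℕ-encode k _) (cong toℕ (encode-decode k p))

uid-injective : ∀ k {u v : Vertex k n} → uid k n u ≡ uid k n v → u ≡ v
uid-injective k {u} {v} eq = begin
  u                     ≡⟨ decode-encode k u ⟨
  decode k (encode k u) ≡⟨ cong (decode k) (Finₚ.toℕ-injective
                             (trans (sym (uid≡toℕ-encode k u)) (trans eq (uid≡toℕ-encode k v)))) ⟩
  decode k (encode k v) ≡⟨ decode-encode k v ⟩
  v                     ∎
  where open ≡-Reasoning

∑ᵥ : ∀ k → (Vertex k n → ℕ) → ℕ
∑ᵥ k f = sum (f ∘ decode k)

∑ᵥ-suc : ∀ k (f : Vertex (suc k) n → ℕ) → ∑ᵥ (suc k) f ≡ sum (λ i → ∑ᵥ k (λ u → f (i , u)))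
∑ᵥ-suc {n = n} k f = trans (∑-combine (suc (t k n)) (t k n) _)
  (sum-cong-≗ λ i → sum-cong-≗ λ p → cong f (decode-combine k i p))

-- The boundary of a vertex set and its behaviour under complementation.

copy : (Vertex (suc k) n → Bool) → Fin (suc (t k n)) → Vertex k n → Bool
copy χ i u = χ (i , u)

# : ∀ k → (Vertex k n → Bool) → ℕ
# k χ = ∑ᵥ k (⟦_⟧ ∘ χ)

-- punchOut encodes the wiring: for i ≠ j the edge between copies i and j joins the vertices
-- with uids punchOut i≢j and punchOut j≢i.
cross : (Vertex (suc k) n → Bool) → Fin (suc (t k n)) → Fin (suc (t k n)) → ℕ
cross {k = k} χ i j with i Fin.≟ j
... | yes _  = 0
... | no i≢j = ⟦ χ (i , decode k (punchOut i≢j)) ⟧ * ⟦ not (χ (j , decode k (punchOut (i≢j ∘ sym)))) ⟧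

-- The number of edges leaving the set with indicator χ, each counted from its end inside the set.
cut : ∀ k → (Vertex k n → Bool) → ℕ
cut zero    χ = # 0 χ * # 0 (not ∘ χ)
cut (suc k) χ = sum (λ i → cut k (copy χ i)) + sum (λ i → sum (cross {k} χ i))

#-suc : ∀ k (χ : Vertex (suc k) n → Bool) → # (suc k) χ ≡ sum (λ i → # k (copy χ i))
#-suc k χ = ∑ᵥ-suc k (⟦_⟧ ∘ χ)

#-not-not : ∀ k (χ : Vertex k n → Bool) → # k (not ∘ not ∘ χ) ≡ # k χ
#-not-not k χ = sum-cong-≗ λ p → cong ⟦_⟧ (not-involutive (χ (decode k p)))

#≡0 : ∀ k (χ : Vertex k n → Bool) → # k χ ≡ 0 → ∀ p → χ (decode k p) ≡ false
#≡0 k χ eq p = ⟦⟧≡0 _ (n≤0⇒n≡0 (≤-trans (term≤sum (⟦_⟧ ∘ χ ∘ decode k) p) (≤-reflexive eq)))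

#not≡0 : ∀ k (χ : Vertex k n → Bool) → # k (not ∘ χ) ≡ 0 → ∀ p → χ (decode k p) ≡ true
#not≡0 k χ eq p = not≡false _ (#≡0 k (not ∘ χ) eq p)

#+#not : (χ : Vertex 0 n → Bool) → # 0 χ + # 0 (not ∘ χ) ≡ n
#+#not χ = trans (sym (∑-distrib-+ (⟦_⟧ ∘ χ) (⟦_⟧ ∘ not ∘ χ))) (trans (sum-cong-≗ (⟦⟧+⟦not⟧ ∘ χ)) (sum-ones _))
  where
  sum-ones : ∀ m → sum {m} (λ _ → 1) ≡ m
  sum-ones zero    = refl
  sum-ones (suc m) = cong suc (sum-ones m)

cross-≢ : ∀ k (χ : Vertex (suc k) n → Bool) {i j} (i≢j : i ≢ j) →
          cross {k} χ i j ≡ ⟦ χ (i , decode k (punchOut i≢j)) ⟧ * ⟦ not (χ (j , decode k (punchOut (i≢j ∘ sym)))) ⟧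
cross-≢ k χ {i} {j} i≢j with i Fin.≟ j
... | yes eq = contradiction eq i≢j
... | no _   = cong₂ (λ p q → ⟦ χ (i , decode k p) ⟧ * ⟦ not (χ (j , decode k q)) ⟧)
                     (punchOut-cong i refl) (punchOut-cong j refl)

-- `punchIn i` lists the other copies, and the edge to copy `punchIn i p` starts at the vertex with
-- uid `p`. Hence each vertex of copy `i` has exactly one edge out of its copy at this level, and a
-- row of `cross` becomes a sum over the vertices of copy `i`.
cross-punchIn : ∀ k (χ : Vertex (suc k) n → Bool) i p →
  cross {k} χ i (punchIn i p) ≡
  ⟦ χ (i , decode k p) ⟧ * ⟦ not (χ (punchIn i p , decode k (punchOut (punchInᵢ≢i i p)))) ⟧
cross-punchIn k χ i p = trans (cross-≢ k χ (punchInᵢ≢i i p ∘ sym))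
  (cong₂ (λ q r → ⟦ χ (i , decode k q) ⟧ * ⟦ not (χ (punchIn i p , decode k r)) ⟧)
    (punchOut-punchIn i) (punchOut-cong (punchIn i p) refl))

cross-not : ∀ k (χ : Vertex (suc k) n → Bool) i j → cross {k} (not ∘ χ) i j ≡ cross {k} χ j i
cross-not k χ i j with j Fin.≟ i
cross-not k χ i j | yes refl with i Fin.≟ i
... | yes _  = refl
... | no i≢i = contradiction refl i≢i
cross-not k χ i j | no j≢i = trans (cross-≢ k (not ∘ χ) (j≢i ∘ sym)) (trans
  (cong (λ a → ⟦ not (χ (i , decode k (punchOut (j≢i ∘ sym)))) ⟧ * ⟦ a ⟧)
    (trans (not-involutive _) (cong (λ p → χ (j , decode k p)) (punchOut-cong j refl))))
  (*-comm ⟦ not (χ (i , decode k (punchOut (j≢i ∘ sym)))) ⟧ _))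

-- Complementation reverses every boundary edge: the two factors at level 0 swap, and the matrix
-- `cross` is transposed.
cut-not : ∀ k (χ : Vertex k n → Bool) → cut k (not ∘ χ) ≡ cut k χ
cut-not zero    χ = trans (cong (# 0 (not ∘ χ) *_) (#-not-not 0 χ)) (*-comm (# 0 (not ∘ χ)) _)
cut-not (suc k) χ = cong₂ _+_ (sum-cong-≗ (λ i → cut-not k (copy χ i)))
  (trans (sum-cong-≗ λ i → sum-cong-≗ (cross-not k χ i)) (∑-comm λ i j → cross {k} χ j i))

-- Boundary edges between different copies.

sum-punchIn≤sum : ∀ {m} (f : Fin (suc m) → ℕ) i → sum (f ∘ punchIn i) ≤ sum f
sum-punchIn≤sum f i = ≤-trans (m≤n+m _ _) (≤-reflexive (sym (sum-remove {i = i} f)))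

module _ {n : ℕ} (k : ℕ) (χ : Vertex (suc k) n → Bool) (i : Fin (suc (t k n))) where
  private
    -- Tells whether the other end of the top level edge at vertex `p` of copy `i` lies in the set.
    far : Fin (t k n) → Bool
    far p = χ (punchIn i p , decode k (punchOut (punchInᵢ≢i i p)))

    far≤# : ∀ p → ⟦ far p ⟧ ≤ # k (copy χ (punchIn i p))
    far≤# p = term≤sum (⟦_⟧ ∘ copy χ (punchIn i p) ∘ decode k) (punchOut (punchInᵢ≢i i p))

    cover : ∀ a b → ⟦ a ⟧ ≤ ⟦ a ⟧ * ⟦ not b ⟧ + ⟦ b ⟧
    cover true  true  = ≤-refl
    cover true  false = ≤-refl
    cover false b     = z≤n

    -- A vertex of the set in copy `i` either has its top level edge cut or has its neighbour along
    -- that edge in the set; `cover` is this alternative in numbers.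
    #copy≤cross+far : # k (copy χ i) ≤ sum (cross {k} χ i) + sum (⟦_⟧ ∘ far)
    #copy≤cross+far = begin
      # k (copy χ i)
        ≤⟨ sum-mono (λ p → cover (χ (i , decode k p)) (far p)) ⟩
      sum (λ p → ⟦ χ (i , decode k p) ⟧ * ⟦ not (far p) ⟧ + ⟦ far p ⟧)
        ≡⟨ ∑-distrib-+ _ (⟦_⟧ ∘ far) ⟩
      sum (λ p → ⟦ χ (i , decode k p) ⟧ * ⟦ not (far p) ⟧) + sum (⟦_⟧ ∘ far)
        ≡⟨ cong (_+ sum (⟦_⟧ ∘ far)) (sum-cong-≗ (cross-punchIn k χ i)) ⟨
      sum (cross {k} χ i ∘ punchIn i) + sum (⟦_⟧ ∘ far)
        ≤⟨ +-monoˡ-≤ (sum (⟦_⟧ ∘ far)) (sum-punchIn≤sum (cross {k} χ i) i) ⟩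
      sum (cross {k} χ i) + sum (⟦_⟧ ∘ far) ∎
      where open ≤-Reasoning

  #copy≤cross : (∀ j → j ≢ i → # k (copy χ j) ≡ 0) → # k (copy χ i) ≤ sum (cross {k} χ i)
  #copy≤cross empty = ≤-trans #copy≤cross+far (≤-reflexive
    (trans (cong (sum (cross {k} χ i) +_) (sum-zero λ p →
      n≤0⇒n≡0 (≤-trans (far≤# p) (≤-reflexive (empty _ (punchInᵢ≢i i p)))))) (+-identityʳ _)))

  -- Far ends in the set can only lie in copy `j`, and a single edge joins copies `i` and `j`; that
  -- edge accounts for the 1.
  #copy≤cross+1 : ∀ {j} → i ≢ j → (∀ l → l ≢ i → l ≢ j → # k (copy χ l) ≡ 0) →
                  # k (copy χ i) ≤ sum (cross {k} χ i) + 1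
  #copy≤cross+1 {j} i≢j empty = ≤-trans #copy≤cross+far (+-monoʳ-≤ (sum (cross {k} χ i))
    (≤-trans (sum≤term (⟦_⟧ ∘ far) (punchOut i≢j) far≡0) (⟦⟧≤1 (far (punchOut i≢j)))))
    where
    far≡0 : ∀ p → p ≢ punchOut i≢j → ⟦ far p ⟧ ≡ 0
    far≡0 p p≢ = n≤0⇒n≡0 (≤-trans (far≤# p) (≤-reflexive (empty _ (punchInᵢ≢i i p)
      λ eq → p≢ (trans (sym (punchOut-punchIn i)) (punchOut-cong i eq)))))

-- t k n edge-disjoint routes lead from a full copy i to an empty copy j, one through each copy l ≠ i
-- (the direct edge for l = j), and each of them contains a cut edge.
separated : ∀ k (χ : Vertex (suc k) n → Bool) {i j} →
  (∀ l → 1 ≤ # k (copy χ l) → 1 ≤ # k (not ∘ copy χ l) → 1 ≤ cut k (copy χ l)) →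
  # k (not ∘ copy χ i) ≡ 0 → # k (copy χ j) ≡ 0 → t k n ≤ cut (suc k) χ
separated {n = n} k χ {i} {j} connected full empty = begin
  t k n
    ≤⟨ sum-≥-count route ⟩
  sum (λ p → c (o p) + (x i (o p) + x (o p) j))
    ≡⟨ trans (∑-distrib-+ (c ∘ o) _) (cong (sum (c ∘ o) +_) (∑-distrib-+ (x i ∘ o) _)) ⟩
  sum (c ∘ o) + (sum (x i ∘ o) + sum (λ p → x (o p) j))
    ≤⟨ +-mono-≤ (sum-punchIn≤sum c i)
         (+-mono-≤ (sum-punchIn≤sum (x i) i) (sum-mono λ p → term≤sum (x (o p)) j)) ⟩
  sum c + (sum (x i) + sum (λ p → sum (x (o p))))
    ≡⟨ cong (sum c +_) (sum-remove {i = i} (sum ∘ x)) ⟨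
  cut (suc k) χ ∎
  where
  open ≤-Reasoning
  c = λ l → cut k (copy χ l)
  x = cross {k} χ
  o = punchIn i

  cross≡1 : ∀ {l m} → l ≢ m → # k (not ∘ copy χ l) ≡ 0 → # k (copy χ m) ≡ 0 → x l m ≡ 1
  cross≡1 {l} {m} l≢m lfull mempty = trans (cross-≢ k χ l≢m)
    (cong₂ (λ a b → ⟦ a ⟧ * ⟦ not b ⟧) (#not≡0 k (copy χ l) lfull _) (#≡0 k (copy χ m) mempty _))

  route : ∀ p → 1 ≤ c (o p) + (x i (o p) + x (o p) j)
  route p with 1 ≤? # k (copy χ (o p)) | 1 ≤? # k (not ∘ copy χ (o p))
  ... | yes a | yes b = ≤-trans (connected (o p) a b) (m≤m+n _ _)
  ... | no a  | _     = ≤-trans (≤-reflexive (sym (cross≡1 (punchInᵢ≢i i p ∘ sym) full (¬1≤⇒≡0 a))))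
                          (≤-trans (m≤m+n _ _) (m≤n+m _ (c (o p))))
  ... | _     | no b  = ≤-trans (≤-reflexive (sym (cross≡1 op≢j (¬1≤⇒≡0 b) empty)))
                          (≤-trans (m≤n+m _ (x i (o p))) (m≤n+m _ (c (o p))))
    where
    op≢j : o p ≢ j
    op≢j refl with () ← trans (sym (#not≡0 k (copy χ j) (¬1≤⇒≡0 b) p)) (#≡0 k (copy χ j) empty p)

-- Lower bounds for the boundary with weighted vertices.

-- The boundary size in D_{k+a,n} of a set contained in one copy of D_{k,n}.
energy : ∀ (a k : ℕ) → (Vertex k n → Bool) → ℕ
energy a k χ = cut k χ + a * # k χ

-- Vertex counts add up over the copies, and the boundary edges between copies are dropped.
∑energy≤energy : ∀ a k (χ : Vertex (suc k) n → Bool) →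
                 sum (λ i → energy a k (copy χ i)) ≤ energy a (suc k) χ
∑energy≤energy a k χ = begin
  sum (λ i → cut k (copy χ i) + a * # k (copy χ i))
    ≡⟨ ∑-distrib-+ (λ i → cut k (copy χ i)) (λ i → a * # k (copy χ i)) ⟩
  sum (λ i → cut k (copy χ i)) + sum (λ i → a * # k (copy χ i))
    ≡⟨ cong (sum (λ i → cut k (copy χ i)) +_)
            (trans (cong (a *_) (#-suc k χ)) (*-distribˡ-sum a (λ i → # k (copy χ i)))) ⟨
  sum (λ i → cut k (copy χ i)) + a * # (suc k) χ
    ≤⟨ +-monoˡ-≤ (a * # (suc k) χ) (m≤m+n _ _) ⟩
  energy a (suc k) χ ∎
  where open ≤-Reasoning

#≤#copy : ∀ k (χ : Vertex (suc k) n → Bool) i → (∀ l → l ≢ i → # k (copy χ l) ≡ 0) →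
          # (suc k) χ ≤ # k (copy χ i)
#≤#copy k χ i empty = ≤-trans (≤-reflexive (#-suc k χ)) (sum≤term (λ l → # k (copy χ l)) i empty)

not-all-empty : ∀ {j} k (χ : Vertex (suc k) n → Bool) → suc j ≤ # (suc k) χ → ¬ (∀ i → # k (copy χ i) ≡ 0)
not-all-empty k χ j<# empty with () ← ≤-trans j<# (≤-reflexive (trans (#-suc k χ) (sum-zero empty)))

energy-complete : ∀ {m m′ a j} → m + m′ ≡ n → j ≤ m → j ≤ a → j * (n + 0 + a) ≤ m * m′ + a * m + j * j
energy-complete {m′ = m′} {j = j} refl j≤m j≤a with m≤n⇒∃[o]m+o≡n j≤m | m≤n⇒∃[o]m+o≡n j≤a
... | u , refl | w , refl = ≤-trans (m≤m+n _ (u * (m′ + w))) (≤-reflexive (identity j u w m′))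
  where
  -- The difference of the two sides is (m − j)(m′ + a − j).
  identity : ∀ j u w m′ → j * (j + u + m′ + 0 + (j + w)) + u * (m′ + w) ≡
                          (j + u) * m′ + (j + w) * (j + u) + j * j
  identity = solve-∀

-- By `#copy≤cross` the cut top level edges act as one extra unit of weight per vertex, so level
-- `suc k` with weight `a` becomes level `k` with weight `suc a`. The case `a = 0` serves the cuts
-- of the whole graph.
concentrated : ∀ a j k (χ : Vertex (suc k) n → Bool) i → (∀ l → l ≢ i → # k (copy χ l) ≡ 0) →
  j * (n + k + suc a) ≤ energy (suc a) k (copy χ i) + j * j →
  j * (n + suc k + a) ≤ energy a (suc k) χ + j * j
concentrated {n} a j k χ i empty bound = begin
  j * (n + suc k + a)
    ≡⟨ shift j n k a ⟩
  j * (n + k + suc a)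
    ≤⟨ bound ⟩
  cut k (copy χ i) + (# k (copy χ i) + a * # k (copy χ i)) + j * j
    ≤⟨ +-monoˡ-≤ (j * j) (≤-trans (≤-reflexive (sym (+-assoc (cut k (copy χ i)) _ _)))
         (+-mono-≤ (+-mono-≤ (term≤sum (λ l → cut k (copy χ l)) i)
           (≤-trans (#copy≤cross k χ i empty) (term≤sum (λ l → sum (cross {k = k} χ l)) i)))
         (*-monoʳ-≤ a (≤-trans (term≤sum (λ l → # k (copy χ l)) i) (≤-reflexive (sym (#-suc k χ))))))) ⟩
  energy a (suc k) χ + j * j ∎
  where
  open ≤-Reasoning
  shift : ∀ j n k a → j * (n + suc k + a) ≡ j * (n + k + suc a)
  shift = solve-∀

-- In this and the next three lemmas `N` is `n + k + a` for a single copy (`a = 0` for cuts of the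
-- whole graph), `suc N` is its value one level up, and the added constants 1, 4, 9 are the squares
-- `j * j`. Here twice N - 1 must reach N, whence `2 ≤ N`.
two-singles₁ : ∀ {N x y E} → 2 ≤ N → 1 * N ≤ x + 1 → 1 * N ≤ y + 1 → x + y ≤ E → 1 * suc N ≤ E + 1
two-singles₁ {N} {x} {y} {E} 2≤N p q r = +-cancelʳ-≤ 1 _ _ (begin
  1 * suc N + 1      ≡⟨ e₁ N ⟩
  2 + N              ≤⟨ +-monoˡ-≤ N 2≤N ⟩
  N + N              ≡⟨ e₂ N ⟩
  1 * N + 1 * N      ≤⟨ +-mono-≤ p q ⟩
  x + 1 + (y + 1)    ≡⟨ e₃ x y ⟩
  x + y + 1 + 1      ≤⟨ +-monoˡ-≤ 1 (+-monoˡ-≤ 1 r) ⟩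
  E + 1 + 1          ∎)
  where
  open ≤-Reasoning
  e₁ : ∀ N → 1 * suc N + 1 ≡ 2 + N
  e₁ = solve-∀
  e₂ : ∀ N → N + N ≡ 1 * N + 1 * N
  e₂ = solve-∀
  e₃ : ∀ x y → x + 1 + (y + 1) ≡ x + y + 1 + 1
  e₃ = solve-∀

-- There is no slack: 2(N - 1) = 2(N + 1) - 4.
two-singles₂ : ∀ {N x y E} → 1 * N ≤ x + 1 → 1 * N ≤ y + 1 → x + y ≤ E → 2 * suc N ≤ E + 4
two-singles₂ {N} {x} {y} {E} p q r = begin
  2 * suc N              ≡⟨ e₁ N ⟩
  1 * N + 1 * N + 2      ≤⟨ +-monoˡ-≤ 2 (+-mono-≤ p q) ⟩
  x + 1 + (y + 1) + 2    ≡⟨ e₂ x y ⟩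
  x + y + 4              ≤⟨ +-monoˡ-≤ 4 r ⟩
  E + 4                  ∎
  where
  open ≤-Reasoning
  e₁ : ∀ N → 2 * suc N ≡ 1 * N + 1 * N + 2
  e₁ = solve-∀
  e₂ : ∀ x y → x + 1 + (y + 1) + 2 ≡ x + y + 4
  e₂ = solve-∀

-- (2N - 4) + (N - 1) exceeds 3(N + 1) - 9 by 1.
double-and-single : ∀ {N x y E} → 2 * N ≤ x + 4 → 1 * N ≤ y + 1 → x + y ≤ E → 3 * suc N ≤ E + 9
double-and-single {N} {x} {y} {E} p q r = begin
  3 * suc N              ≡⟨ e₁ N ⟩
  2 * N + 1 * N + 3      ≤⟨ +-monoˡ-≤ 3 (+-mono-≤ p q) ⟩
  x + 4 + (y + 1) + 3    ≡⟨ e₂ x y ⟩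
  x + y + 8              ≤⟨ +-mono-≤ r (n≤1+n 8) ⟩
  E + 9                  ∎
  where
  open ≤-Reasoning
  e₁ : ∀ N → 3 * suc N ≡ 2 * N + 1 * N + 3
  e₁ = solve-∀
  e₂ : ∀ x y → x + 4 + (y + 1) + 3 ≡ x + y + 8
  e₂ = solve-∀

-- 3(N - 1) exceeds 3(N + 1) - 9 by 3.
three-singles : ∀ {N x y z E} → 1 * N ≤ x + 1 → 1 * N ≤ y + 1 → 1 * N ≤ z + 1 →
                x + (y + z) ≤ E → 3 * suc N ≤ E + 9
three-singles {N} {x} {y} {z} {E} p q r s = begin
  3 * suc N                          ≡⟨ e₁ N ⟩
  1 * N + (1 * N + 1 * N) + 3        ≤⟨ +-monoˡ-≤ 3 (+-mono-≤ p (+-mono-≤ q r)) ⟩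
  x + 1 + (y + 1 + (z + 1)) + 3      ≡⟨ e₂ x y z ⟩
  x + (y + z) + 6                    ≤⟨ +-mono-≤ s (m≤m+n 6 3) ⟩
  E + 9                              ∎
  where
  open ≤-Reasoning
  e₁ : ∀ N → 3 * suc N ≡ 1 * N + (1 * N + 1 * N) + 3
  e₁ = solve-∀
  e₂ : ∀ x y z → x + 1 + (y + 1 + (z + 1)) + 3 ≡ x + (y + z) + 6
  e₂ = solve-∀

one-of-two-large : ∀ {x y} → 3 ≤ x + y → 2 ≤ x ⊎ 2 ≤ y
one-of-two-large {zero}        p = inj₂ (≤-trans (n≤1+n 2) p)
one-of-two-large {suc zero}    p = inj₂ (s≤s⁻¹ p)
one-of-two-large {suc (suc _)} p = inj₁ (s≤s (s≤s z≤n))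

module _ {n : ℕ} (3≤n : 3 ≤ n) where

  private
    2≤N : ∀ k → 2 ≤ n + k
    2≤N k = ≤-trans (n≤1+n 2) (≤-trans 3≤n (m≤m+n n k))

    rotate : ∀ j k a {E} → j * suc (n + k + a) ≤ E → j * (n + suc k + a) ≤ E
    rotate j k a {E} = subst (λ N → j * N ≤ E) (sym (cong (_+ a) (+-suc n k)))

    #copies : ∀ k → (Vertex (suc k) n → Bool) → Fin (suc (t k n)) → ℕ
    #copies k χ i = # k (copy χ i)

    energies : ∀ a k → (Vertex (suc k) n → Bool) → Fin (suc (t k n)) → ℕ
    energies a k χ i = energy a k (copy χ i)

  -- The three bounds carry `j * j` on the right in place of a truncated subtraction. In the case
  -- `three`, two of the nonempty copies already give enough.
  energy-bound₁ : ∀ a k (χ : Vertex k n → Bool) → 1 ≤ a → 1 ≤ # k χ →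
                  1 * (n + k + a) ≤ energy a k χ + 1
  energy-bound₁ a zero    χ 1≤a 1≤# = energy-complete (#+#not χ) 1≤# 1≤a
  energy-bound₁ a (suc k) χ 1≤a 1≤# = go (support (#copies k χ))
    where
    rec : ∀ i → 1 ≤ # k (copy χ i) → 1 * (n + k + a) ≤ energies a k χ i + 1
    rec i = energy-bound₁ a k (copy χ i) 1≤a

    pair : ∀ i j → i ≢ j → 1 ≤ # k (copy χ i) → 1 ≤ # k (copy χ j) →
           1 * (n + suc k + a) ≤ energy a (suc k) χ + 1
    pair i j i≢j pi pj = rotate 1 k a (two-singles₁ (≤-trans (2≤N k) (m≤m+n _ a)) (rec i pi) (rec j pj)
      (≤-trans (two-terms≤sum (energies a k χ) i≢j) (∑energy≤energy a k χ)))

    go : Support (#copies k χ) → 1 * (n + suc k + a) ≤ energy a (suc k) χ + 1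
    go (none e)                     = contradiction e (not-all-empty k χ 1≤#)
    go (one i e)                    = concentrated a 1 k χ i e
      (energy-bound₁ (suc a) k (copy χ i) z<s (≤-trans 1≤# (#≤#copy k χ i e)))
    go (two i j i≢j pi pj _)          = pair i j i≢j pi pj
    go (three i j _ i≢j _ _ pi pj _)  = pair i j i≢j pi pj

  -- The condition `2 ≤ k + a` survives the descent into a single copy, which trades `k` for `a`,
  -- and becomes `2 ≤ a` in the complete graph. At `k = 0`, `a = 1` the full vertex set would
  -- violate the bound.
  energy-bound₂ : ∀ a k (χ : Vertex k n → Bool) → 1 ≤ a → 2 ≤ k + a → 2 ≤ # k χ →
                  2 * (n + k + a) ≤ energy a k χ + 4
  energy-bound₂ a zero    χ 1≤a 2≤a 2≤# = energy-complete (#+#not χ) 2≤# 2≤a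
  energy-bound₂ a (suc k) χ 1≤a 2≤k+a 2≤# = go (support (#copies k χ))
    where
    rec : ∀ i → 1 ≤ # k (copy χ i) → 1 * (n + k + a) ≤ energies a k χ i + 1
    rec i = energy-bound₁ a k (copy χ i) 1≤a

    pair : ∀ i j → i ≢ j → 1 ≤ # k (copy χ i) → 1 ≤ # k (copy χ j) →
           2 * (n + suc k + a) ≤ energy a (suc k) χ + 4
    pair i j i≢j pi pj = rotate 2 k a (two-singles₂ {N = n + k + a} (rec i pi) (rec j pj)
      (≤-trans (two-terms≤sum (energies a k χ) i≢j) (∑energy≤energy a k χ)))

    go : Support (#copies k χ) → 2 * (n + suc k + a) ≤ energy a (suc k) χ + 4
    go (none e)                     = contradiction e (not-all-empty k χ 2≤#)
    go (one i e)                    = concentrated a 2 k χ i e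
      (energy-bound₂ (suc a) k (copy χ i) z<s (subst (2 ≤_) (sym (+-suc k a)) 2≤k+a)
        (≤-trans 2≤# (#≤#copy k χ i e)))
    go (two i j i≢j pi pj _)          = pair i j i≢j pi pj
    go (three i j _ i≢j _ _ pi pj _)  = pair i j i≢j pi pj

  -- If exactly two copies are nonempty, one of them has at least two of the vertices: it gets the
  -- bound for two and the other the bound for one. Going down to a copy turns `3 ≤ suc k + a` into
  -- the `2 ≤ k + a` that `energy-bound₂` asks for.
  energy-bound₃ : ∀ a k (χ : Vertex k n → Bool) → 1 ≤ a → 3 ≤ k + a → 3 ≤ # k χ →
                  3 * (n + k + a) ≤ energy a k χ + 9
  energy-bound₃ a zero    χ 1≤a 3≤a 3≤# = energy-complete (#+#not χ) 3≤# 3≤a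
  energy-bound₃ a (suc k) χ 1≤a 3≤k+a 3≤# = go (support (#copies k χ))
    where
    rec₁ : ∀ i → 1 ≤ # k (copy χ i) → 1 * (n + k + a) ≤ energies a k χ i + 1
    rec₁ i = energy-bound₁ a k (copy χ i) 1≤a

    rec₂ : ∀ i → 2 ≤ # k (copy χ i) → 2 * (n + k + a) ≤ energies a k χ i + 4
    rec₂ i = energy-bound₂ a k (copy χ i) 1≤a (s≤s⁻¹ 3≤k+a)

    pair : ∀ i j → i ≢ j → 2 ≤ # k (copy χ i) → 1 ≤ # k (copy χ j) →
           3 * (n + suc k + a) ≤ energy a (suc k) χ + 9
    pair i j i≢j pi pj = rotate 3 k a (double-and-single {N = n + k + a} (rec₂ i pi) (rec₁ j pj)
      (≤-trans (two-terms≤sum (energies a k χ) i≢j) (∑energy≤energy a k χ)))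

    go : Support (#copies k χ) → 3 * (n + suc k + a) ≤ energy a (suc k) χ + 9
    go (none e)                     = contradiction e (not-all-empty k χ 3≤#)
    go (one i e)                    = concentrated a 3 k χ i e
      (energy-bound₃ (suc a) k (copy χ i) z<s (subst (3 ≤_) (sym (+-suc k a)) 3≤k+a)
        (≤-trans 3≤# (#≤#copy k χ i e)))
    go (two i j i≢j pi pj e)
      with one-of-two-large (≤-trans 3≤# (≤-trans (≤-reflexive (#-suc k χ)) (sum≤two-terms (#copies k χ) i≢j e)))
    ... | inj₁ 2≤i = pair i j i≢j 2≤i pj
    ... | inj₂ 2≤j = pair j i (i≢j ∘ sym) 2≤j pi
    go (three i j l i≢j i≢l j≢l pi pj pl) = rotate 3 k a
      (three-singles {N = n + k + a} (rec₁ i pi) (rec₁ j pj) (rec₁ l pl)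
        (≤-trans (three-terms≤sum (energies a k χ) i≢j i≢l j≢l) (∑energy≤energy a k χ)))

  -- Growth of the number of vertices.

  n+k≤t : ∀ k → n + k ≤ t k n
  n+k≤t zero    = ≤-reflexive (+-identityʳ n)
  n+k≤t (suc k) = begin
    n + suc k              ≡⟨ +-suc n k ⟩
    suc (n + k)            ≤⟨ s≤s (n+k≤t k) ⟩
    suc (t k n)            ≡⟨ *-identityʳ _ ⟨
    suc (t k n) * 1        ≤⟨ *-monoʳ-≤ (suc (t k n)) (≤-trans (≤-trans (n≤1+n 1) (2≤N k)) (n+k≤t k)) ⟩
    suc (t k n) * t k n    ∎
    where open ≤-Reasoning

  3≤t : ∀ k → 3 ≤ t k n
  3≤t k = ≤-trans 3≤n (≤-trans (m≤m+n n k) (n+k≤t k))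

  t+3≤t-suc : ∀ k → 3 + t k n ≤ t (suc k) n
  t+3≤t-suc k = ≤-trans (≤-reflexive (+-comm 3 _)) (+-monoʳ-≤ (t k n)
    (≤-trans (≤-trans (3≤t k) (≤-reflexive (sym (*-identityʳ _))))
             (*-monoʳ-≤ (t k n) (≤-trans (m≤m+n 1 2) (3≤t k)))))

  3n≤t₁ : 3 * n ≤ t 1 n
  3n≤t₁ = ≤-trans (*-monoˡ-≤ n 3≤n) (m≤n+m _ n)

  -- Shows that `t k n` cut edges are enough when one copy is full and another empty. Each level
  -- adds 3 to the left side and at least 3 to `t`. The induction starts at `k = 1`, since
  -- `t 0 n = n` is too small.
  3⟨n+k+1⟩≤t+6 : ∀ k → 1 ≤ k → 3 * suc (n + k) ≤ t k n + 6
  3⟨n+k+1⟩≤t+6 (suc zero)    _ = ≤-trans (≤-reflexive (e n)) (+-monoˡ-≤ 6 3n≤t₁)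
    where
    e : ∀ n → 3 * suc (n + 1) ≡ 3 * n + 6
    e = solve-∀
  3⟨n+k+1⟩≤t+6 (suc (suc k)) _ = begin
    3 * suc (n + suc (suc k))    ≡⟨ e n k ⟩
    3 + 3 * suc (n + suc k)      ≤⟨ +-monoʳ-≤ 3 (3⟨n+k+1⟩≤t+6 (suc k) z<s) ⟩
    3 + (t (suc k) n + 6)        ≡⟨ +-assoc 3 (t (suc k) n) 6 ⟨
    3 + t (suc k) n + 6          ≤⟨ +-monoˡ-≤ 6 (t+3≤t-suc (suc k)) ⟩
    t (suc (suc k)) n + 6        ∎
    where
    open ≤-Reasoning
    e : ∀ n k → 3 * suc (n + suc (suc k)) ≡ 3 + 3 * suc (n + suc k)
    e = solve-∀

  -- Cuts of the whole graph.

  -- Common case split for edge-connectivity (`j = 1`) and the restricted bound (`j = 3`). Both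
  -- sides must have `j` vertices because `noFull` may be applied to either of them.
  by-copies : ∀ {B c j} k (χ : Vertex (suc k) n → Bool) →
    (∀ (ψ : Vertex k n → Bool) → 1 ≤ # k ψ → 1 ≤ # k (not ∘ ψ) → 1 * (n + k) ≤ cut k ψ + 1) →
    B ≤ t k n + c →
    (∀ (ψ : Vertex (suc k) n → Bool) → (∀ i → 1 ≤ # k (not ∘ copy ψ i)) → j ≤ # (suc k) ψ →
      B ≤ cut (suc k) ψ + c) →
    j ≤ # (suc k) χ → j ≤ # (suc k) (not ∘ χ) → B ≤ cut (suc k) χ + c
  by-copies {B} {c} k χ connected large noFull j≤# j≤#not
    with any? (λ i → # k (not ∘ copy χ i) ≟ 0) | any? (λ i → # k (copy χ i) ≟ 0)
  ... | no full | _ = noFull χ (λ i → n≢0⇒n>0 (λ eq → full (i , eq))) j≤#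
  -- The full copies of the complement are the empty copies of `χ`, so here the complement has none,
  -- and its boundary has the same size.
  ... | yes _ | no empty = subst (λ x → B ≤ x + c) (cut-not (suc k) χ)
    (noFull (not ∘ χ) (λ i → n≢0⇒n>0 (λ eq → empty (i , trans (sym (#-not-not k (copy χ i))) eq))) j≤#not)
  ... | yes (i , full) | yes (j , empty) = ≤-trans large
    (+-monoˡ-≤ c (separated k χ {i} {j} (λ l p q → 1≤cut (connected (copy χ l) p q)) full empty))
    where
    1≤cut : ∀ {c} → 1 * (n + k) ≤ c + 1 → 1 ≤ c
    1≤cut p = +-cancelʳ-≤ 1 1 _ (≤-trans (2≤N k) (≤-trans (≤-reflexive (sym (*-identityˡ _))) p))

  private
    cuts : ∀ k → (Vertex (suc k) n → Bool) → Fin (suc (t k n)) → ℕ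
    cuts k χ i = cut k (copy χ i)

    from-energy : ∀ j k (χ : Vertex k n → Bool) {c} →
                  j * (n + k + 0) ≤ energy 0 k χ + c → j * (n + k) ≤ cut k χ + c
    from-energy j k χ {c} =
      subst₂ _≤_ (cong (j *_) (+-identityʳ (n + k))) (cong (_+ c) (+-identityʳ (cut k χ)))

  -- The bound n + k - 1 is the degree of every vertex. When no copy is full, the induction
  -- hypothesis applies inside each nonempty copy, and two such copies suffice; a single one is
  -- handled by `energy-bound₁` with weight 1.
  edge-connectivity : ∀ k (χ : Vertex k n → Bool) → 1 ≤ # k χ → 1 ≤ # k (not ∘ χ) →
                      1 * (n + k) ≤ cut k χ + 1
  edge-connectivity zero χ 1≤# 1≤#not =
    subst (λ N → 1 * (N + 0) ≤ # 0 χ * # 0 (not ∘ χ) + 1) (#+#not χ) (product 1≤# 1≤#not)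
    where
    -- The excess `u * w` is (m - 1)(m′ - 1).
    product : ∀ {m m′} → 1 ≤ m → 1 ≤ m′ → 1 * (m + m′ + 0) ≤ m * m′ + 1
    product {suc u} {suc w} _ _ = ≤-trans (m≤m+n _ (u * w)) (≤-reflexive (e u w))
      where
      e : ∀ u w → 1 * (suc u + suc w + 0) + u * w ≡ suc u * suc w + 1
      e = solve-∀
  edge-connectivity (suc k) χ 1≤# 1≤#not = by-copies k χ (edge-connectivity k) large noFull 1≤# 1≤#not
    where
    large : 1 * (n + suc k) ≤ t k n + 1
    large = ≤-trans (≤-reflexive (e n k)) (+-monoˡ-≤ 1 (n+k≤t k))
      where
      e : ∀ n k → 1 * (n + suc k) ≡ n + k + 1
      e = solve-∀

    noFull : ∀ (ψ : Vertex (suc k) n → Bool) → (∀ i → 1 ≤ # k (not ∘ copy ψ i)) → 1 ≤ # (suc k) ψ →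
             1 * (n + suc k) ≤ cut (suc k) ψ + 1
    noFull ψ proper 1≤#ψ = go (support (#copies k ψ))
      where
      pair : ∀ i j → i ≢ j → 1 ≤ # k (copy ψ i) → 1 ≤ # k (copy ψ j) → 1 * (n + suc k) ≤ cut (suc k) ψ + 1
      pair i j i≢j pi pj = subst (λ N → 1 * N ≤ cut (suc k) ψ + 1) (sym (+-suc n k))
        (two-singles₁ (2≤N k) (edge-connectivity k (copy ψ i) pi (proper i))
          (edge-connectivity k (copy ψ j) pj (proper j))
          (≤-trans (two-terms≤sum (cuts k ψ) i≢j) (m≤m+n _ _)))

      go : Support (#copies k ψ) → 1 * (n + suc k) ≤ cut (suc k) ψ + 1
      go (none e)                      = contradiction e (not-all-empty k ψ 1≤#ψ)
      go (one i e)                     = from-energy 1 (suc k) ψ (concentrated 0 1 k ψ i e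
        (energy-bound₁ 1 k (copy ψ i) ≤-refl (≤-trans 1≤#ψ (#≤#copy k ψ i e))))
      go (two i j i≢j pi pj _)         = pair i j i≢j pi pj
      go (three i j _ i≢j _ _ pi pj _) = pair i j i≢j pi pj

  restricted-edge-connectivity : ∀ k (χ : Vertex (suc k) n → Bool) → 2 ≤ k →
    3 ≤ # (suc k) χ → 3 ≤ # (suc k) (not ∘ χ) → 3 * (n + suc k) ≤ cut (suc k) χ + 9
  restricted-edge-connectivity k χ 2≤k = by-copies k χ (edge-connectivity k) large noFull
    where
    large : 3 * (n + suc k) ≤ t k n + 9
    large = subst (λ N → 3 * N ≤ t k n + 9) (sym (+-suc n k))
      (≤-trans (3⟨n+k+1⟩≤t+6 k (≤-trans (n≤1+n 1) 2≤k)) (+-monoʳ-≤ (t k n) (m≤m+n 6 3)))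

    noFull : ∀ (ψ : Vertex (suc k) n → Bool) → (∀ i → 1 ≤ # k (not ∘ copy ψ i)) → 3 ≤ # (suc k) ψ →
             3 * (n + suc k) ≤ cut (suc k) ψ + 9
    noFull ψ proper 3≤# = go (support (#copies k ψ))
      where
      rec : ∀ i → 1 ≤ # k (copy ψ i) → 1 * (n + k) ≤ cuts k ψ i + 1
      rec i pi = edge-connectivity k (copy ψ i) pi (proper i)

      -- Edge-connectivity of the two copies alone would fall short, so the edges leaving copy `i`
      -- are counted as well: all its chosen vertices but at most one have a cut top level edge.
      -- `energy-bound₂` with weight 1, less this one edge, plus the edge-connectivity of copy `j`
      -- exceeds the target by 2.
      pair : ∀ i j → i ≢ j → (∀ l → l ≢ i → l ≢ j → # k (copy ψ l) ≡ 0) →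
             2 ≤ # k (copy ψ i) → 1 ≤ # k (copy ψ j) → 3 * (n + suc k) ≤ cut (suc k) ψ + 9
      pair i j i≢j e pi pj = begin
        3 * (n + suc k)
          ≡⟨ e₁ n k ⟩
        2 * (n + k + 1) + 1 * (n + k) + 1
          ≤⟨ +-monoˡ-≤ 1 (+-mono-≤ (energy-bound₂ 1 k (copy ψ i) ≤-refl
               (≤-trans 2≤k (m≤m+n k 1)) pi) (rec j pj)) ⟩
        cᵢ + 1 * # k (copy ψ i) + 4 + (cⱼ + 1) + 1
          ≤⟨ +-monoˡ-≤ 1 (+-monoˡ-≤ (cⱼ + 1) (+-monoˡ-≤ 4 (+-monoʳ-≤ cᵢ
               (*-monoʳ-≤ 1 (#copy≤cross+1 k ψ i i≢j e))))) ⟩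
        cᵢ + 1 * (r + 1) + 4 + (cⱼ + 1) + 1
          ≡⟨ e₂ cᵢ cⱼ r ⟩
        cᵢ + cⱼ + r + 7
          ≤⟨ +-mono-≤ (+-mono-≤ (two-terms≤sum (cuts k ψ) i≢j)
               (term≤sum (λ l → sum (cross {k = k} ψ l)) i)) (m≤m+n 7 2) ⟩
        cut (suc k) ψ + 9 ∎
        where
        open ≤-Reasoning
        cᵢ = cuts k ψ i
        cⱼ = cuts k ψ j
        r = sum (cross {k = k} ψ i)
        e₁ : ∀ n k → 3 * (n + suc k) ≡ 2 * (n + k + 1) + 1 * (n + k) + 1
        e₁ = solve-∀
        e₂ : ∀ c d r → c + 1 * (r + 1) + 4 + (d + 1) + 1 ≡ c + d + r + 7
        e₂ = solve-∀

      go : Support (#copies k ψ) → 3 * (n + suc k) ≤ cut (suc k) ψ + 9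
      go (none e)  = contradiction e (not-all-empty k ψ 3≤#)
      -- Weight 1 inside the copy calls for `3 ≤ k + 1`; this uses the full strength of `2 ≤ k`.
      go (one i e) = from-energy 3 (suc k) ψ (concentrated 0 3 k ψ i e
        (energy-bound₃ 1 k (copy ψ i) ≤-refl (≤-trans (s≤s 2≤k) (≤-reflexive (+-comm 1 k)))
          (≤-trans 3≤# (#≤#copy k ψ i e))))
      go (two i j i≢j pi pj e)
        with one-of-two-large (≤-trans 3≤# (≤-trans (≤-reflexive (#-suc k ψ)) (sum≤two-terms (#copies k ψ) i≢j e)))
      ... | inj₁ 2≤i = pair i j i≢j e 2≤i pj
      ... | inj₂ 2≤j = pair j i (i≢j ∘ sym) (λ l l≢j l≢i → e l l≢i l≢j) 2≤j pi
      go (three i j l i≢j i≢l j≢l pi pj pl) = subst (λ N → 3 * N ≤ cut (suc k) ψ + 9) (sym (+-suc n k))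
        (three-singles {N = n + k} (rec i pi) (rec j pj) (rec l pl)
          (≤-trans (three-terms≤sum (cuts k ψ) i≢j i≢l j≢l) (m≤m+n _ _)))

-- Comparing the boundary size with a list of edges.

≟ᵥ : ∀ k → DecidableEquality (Vertex k n)
≟ᵥ zero    = Fin._≟_
≟ᵥ (suc k) = ≡-dec Fin._≟_ (≟ᵥ k)

Adj-sym : ∀ k {x y : Vertex k n} → Adj k n x y → Adj k n y x
Adj-sym zero    x≢y                  = x≢y ∘ sym
Adj-sym (suc k) (inj₁ (refl , adj))  = inj₁ (refl , Adj-sym k adj)
Adj-sym (suc k) (inj₂ (inj₁ lt))     = inj₂ (inj₂ lt)
Adj-sym (suc k) (inj₂ (inj₂ gt))     = inj₂ (inj₁ gt)

toℕ-punchOut-< : ∀ {m} {i j : Fin (suc m)} (i≢j : i ≢ j) → toℕ i < toℕ j → toℕ (punchOut i≢j) ≡ toℕ j ∸ 1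
toℕ-punchOut-< {_}     {zero}  {suc j}       i≢j _ = refl
toℕ-punchOut-< {suc m} {suc i} {suc zero}    i≢j (s≤s ())
toℕ-punchOut-< {suc m} {suc i} {suc (suc j)} i≢j (s≤s lt) = cong suc (toℕ-punchOut-< _ lt)

toℕ-punchOut-> : ∀ {m} {i j : Fin (suc m)} (i≢j : i ≢ j) → toℕ j < toℕ i → toℕ (punchOut i≢j) ≡ toℕ j
toℕ-punchOut-> {suc m} {suc i} {zero}  i≢j _ = refl
toℕ-punchOut-> {suc m} {suc i} {suc j} i≢j (s≤s gt) = cong suc (toℕ-punchOut-> _ gt)

-- For copies a < b, removing a from the indices lowers b to b - 1, while removing b leaves a as it
-- is: these are the two uids of the wiring rule.
Adj-cross : ∀ k {i j : Fin (suc (t k n))} (i≢j : i ≢ j) →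
  Adj (suc k) n (i , decode k (punchOut i≢j)) (j , decode k (punchOut (i≢j ∘ sym)))
Adj-cross k {i} {j} i≢j with <-cmp (toℕ i) (toℕ j)
... | tri< lt _ _ = inj₂ (inj₁ (lt , trans (uid-decode k _) (toℕ-punchOut-< i≢j lt) ,
                                     trans (uid-decode k _) (toℕ-punchOut-> (i≢j ∘ sym) lt)))
... | tri≈ _ eq _ = contradiction (Finₚ.toℕ-injective eq) i≢j
... | tri> _ _ gt = inj₂ (inj₂ (gt , trans (uid-decode k _) (toℕ-punchOut-< (i≢j ∘ sym) gt) ,
                                     trans (uid-decode k _) (toℕ-punchOut-> i≢j gt)))

dart≤ : ∀ a b {z} → (a ≡ true → b ≡ false → 1 ≤ z) → ⟦ a ⟧ * ⟦ not b ⟧ ≤ z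
dart≤ true  true  _   = z≤n
dart≤ true  false 1≤z = 1≤z refl refl
dart≤ false b     _   = z≤n

-- Translates the recursive count into one over ordered pairs of adjacent vertices: every unit of
-- `cut` is charged to its own pair, on which `f` is at least 1.
cut≤∑∑ : ∀ k (χ : Vertex k n → Bool) (f : Vertex k n → Vertex k n → ℕ) →
  (∀ x y → Adj k n x y → χ x ≡ true → χ y ≡ false → 1 ≤ f x y) →
  cut k χ ≤ ∑ᵥ k (λ x → ∑ᵥ k (f x))
cut≤∑∑ zero χ f 1≤f = ≤-trans (≤-reflexive (sum-*-sum (⟦_⟧ ∘ χ) (⟦_⟧ ∘ not ∘ χ)))
  (sum-mono λ x → sum-mono λ y → dart≤ (χ x) (χ y) λ px py →
    1≤f x y (λ x≡y → contradiction (trans (sym px) (trans (cong χ x≡y) py)) λ ()) px py)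
cut≤∑∑ {n} (suc k) χ f 1≤f = begin
  sum (λ i → cut k (copy χ i)) + sum (λ i → sum (cross {k = k} χ i))
    ≡⟨ ∑-distrib-+ (λ i → cut k (copy χ i)) (λ i → sum (cross {k = k} χ i)) ⟨
  sum (λ i → cut k (copy χ i) + sum (cross {k = k} χ i))
    ≤⟨ sum-mono row ⟩
  sum (λ i → sum (T i))
    ≡⟨ sum-cong-≗ (λ i → trans
         (sum-cong-≗ (λ p → ∑ᵥ-suc k (f (i , decode k p))))
         (∑-comm (λ p j → ∑ᵥ k (λ w → f (i , decode k p) (j , w))))) ⟨
  sum (λ i → ∑ᵥ k (λ u → ∑ᵥ (suc k) (f (i , u))))
    ≡⟨ ∑ᵥ-suc k (λ x → ∑ᵥ (suc k) (f x)) ⟨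
  ∑ᵥ (suc k) (λ x → ∑ᵥ (suc k) (f x)) ∎
  where
  open ≤-Reasoning
  -- The double sum is regrouped into blocks of copies. A diagonal block pays for the boundary
  -- inside its copy, by induction; an off-diagonal block pays for the single edge between its two
  -- copies.
  T : Fin (suc (t k n)) → Fin (suc (t k n)) → ℕ
  T i j = ∑ᵥ k (λ u → ∑ᵥ k (λ w → f (i , u) (j , w)))

  cross≤T : ∀ i j → i ≢ j → cross {k = k} χ i j ≤ T i j
  cross≤T i j i≢j = ≤-trans (≤-reflexive (cross-≢ k χ i≢j)) (≤-trans
    (dart≤ _ _ (1≤f _ _ (Adj-cross k i≢j)))
    (≤-trans (term≤sum (λ q → f (i , decode k (punchOut i≢j)) (j , decode k q)) (punchOut (i≢j ∘ sym)))
             (term≤sum (λ p → ∑ᵥ k (λ w → f (i , decode k p) (j , w))) (punchOut i≢j))))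

  cross-diagonal : ∀ i → cross {k = k} χ i i ≡ 0
  cross-diagonal i with i Fin.≟ i
  ... | yes _  = refl
  ... | no i≢i = contradiction refl i≢i

  row : ∀ i → cut k (copy χ i) + sum (cross {k = k} χ i) ≤ sum (T i)
  row i = begin
    cut k (copy χ i) + sum (cross {k = k} χ i)
      ≡⟨ cong (cut k (copy χ i) +_) (trans (sum-remove {i = i} (cross {k = k} χ i))
                                           (cong (_+ off) (cross-diagonal i))) ⟩
    cut k (copy χ i) + off
      ≤⟨ +-mono-≤ (cut≤∑∑ k (copy χ i) (λ u w → f (i , u) (i , w))
                     (λ u w adj → 1≤f (i , u) (i , w) (inj₁ (refl , adj))))
                  (sum-mono λ p → cross≤T i (punchIn i p) (punchInᵢ≢i i p ∘ sym)) ⟩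
    T i i + sum (T i ∘ punchIn i)
      ≡⟨ sum-remove {i = i} (T i) ⟨
    sum (T i) ∎
    where off = sum (cross {k = k} χ i ∘ punchIn i)

module _ {n : ℕ} (k : ℕ) (χ : Vertex k n → Bool) where
  private
    V² = Vertex k n × Vertex k n

    -- A list may hold a boundary edge in either direction. Orienting it to start inside the set
    -- makes each entry hit exactly one ordered pair, so the total of `hits` stays below the length
    -- of the list.
    orient : V² → V²
    orient (x , y) = if χ x then (x , y) else (y , x)

    δ : V² → Vertex k n → Vertex k n → ℕ
    δ e x y = ⟦ does (≡-dec (≟ᵥ k) (≟ᵥ k) (orient e) (x , y)) ⟧

    hits : List V² → Vertex k n → Vertex k n → ℕ
    hits []       x y = 0
    hits (e ∷ es) x y = δ e x y + hits es x y

    δ≡0 : ∀ e x y → orient e ≢ (x , y) → δ e x y ≡ 0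
    δ≡0 e x y e≢ = cong ⟦_⟧ (dec-false (≡-dec (≟ᵥ k) (≟ᵥ k) (orient e) (x , y)) e≢)

    decode≢ : ∀ {p} (v : Vertex k n) → p ≢ encode k v → v ≢ decode k p
    decode≢ v p≢ v≡ = p≢ (sym (trans (cong (encode k) v≡) (encode-decode k _)))

    ∑∑δ≤1 : ∀ e → ∑ᵥ k (λ x → ∑ᵥ k (δ e x)) ≤ 1
    ∑∑δ≤1 e = begin
      ∑ᵥ k (λ x → ∑ᵥ k (δ e x))
        ≤⟨ sum≤term (λ p → ∑ᵥ k (δ e (decode k p))) (encode k a) (λ p p≢ →
             sum-zero {t k n} λ q → δ≡0 e _ (decode k q) (decode≢ a p≢ ∘ cong proj₁)) ⟩
      ∑ᵥ k (δ e (decode k (encode k a)))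
        ≤⟨ sum≤term (λ q → δ e (decode k (encode k a)) (decode k q)) (encode k b) (λ q q≢ →
             δ≡0 e _ _ (decode≢ b q≢ ∘ cong proj₂)) ⟩
      δ e (decode k (encode k a)) (decode k (encode k b))
        ≤⟨ ⟦⟧≤1 _ ⟩
      1 ∎
      where
      open ≤-Reasoning
      a = proj₁ (orient e)
      b = proj₂ (orient e)

    ∑∑hits≤length : ∀ es → ∑ᵥ k (λ x → ∑ᵥ k (hits es x)) ≤ length es
    ∑∑hits≤length []       = ≤-reflexive (sum-zero {t k n} λ p → sum-zero {t k n} λ q → refl)
    ∑∑hits≤length (e ∷ es) = begin
      ∑ᵥ k (λ x → ∑ᵥ k (λ y → δ e x y + hits es x y))
        ≡⟨ trans (sum-cong-≗ λ p → ∑-distrib-+ (δ e (decode k p) ∘ decode k) (hits es (decode k p) ∘ decode k))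
                 (∑-distrib-+ (λ p → ∑ᵥ k (δ e (decode k p))) (λ p → ∑ᵥ k (hits es (decode k p)))) ⟩
      ∑ᵥ k (λ x → ∑ᵥ k (δ e x)) + ∑ᵥ k (λ x → ∑ᵥ k (hits es x))
        ≤⟨ +-mono-≤ (∑∑δ≤1 e) (∑∑hits≤length es) ⟩
      suc (length es) ∎
      where open ≤-Reasoning

    hit : ∀ {e es x y} → e ∈ es → orient e ≡ (x , y) → 1 ≤ hits es x y
    hit {e} {x = x} {y} (here refl) eq = ≤-trans (≤-reflexive (sym (cong ⟦_⟧
      (dec-true (≡-dec (≟ᵥ k) (≟ᵥ k) (orient e) (x , y)) eq)))) (m≤m+n _ _)
    hit (there e∈es) eq = ≤-trans (hit e∈es eq) (m≤n+m _ _)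

  cut≤length : ∀ es →
    (∀ x y → Adj k n x y → χ x ≡ true → χ y ≡ false → (x , y) ∈ es ⊎ (y , x) ∈ es) →
    cut k χ ≤ length es
  cut≤length es covered = ≤-trans (cut≤∑∑ k χ (hits es) 1≤hits) (∑∑hits≤length es)
    where
    1≤hits : ∀ x y → Adj k n x y → χ x ≡ true → χ y ≡ false → 1 ≤ hits es x y
    1≤hits x y adj px py with covered x y adj px py
    ... | inj₁ xy∈ = hit xy∈ (cong (λ b → if b then (x , y) else (y , x)) px)
    ... | inj₂ yx∈ = hit yx∈ (cong (λ b → if b then (y , x) else (x , y)) py)

  three≤# : ∀ {x y z} → χ x ≡ true → χ y ≡ true → χ z ≡ true → x ≢ y → x ≢ z → y ≢ z → 3 ≤ # k χ
  three≤# {x} {y} {z} px py pz x≢y x≢z y≢z = begin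
    3
      ≡⟨ cong₂ _+_ (one≡ px) (cong₂ _+_ (one≡ py) (one≡ pz)) ⟨
    at x + (at y + at z)
      ≤⟨ three-terms≤sum (⟦_⟧ ∘ χ ∘ decode k) (x≢y ∘ inj) (x≢z ∘ inj) (y≢z ∘ inj) ⟩
    # k χ ∎
    where
    open ≤-Reasoning
    at : Vertex k n → ℕ
    at v = ⟦ χ (decode k (encode k v)) ⟧
    one≡ : ∀ {v} → χ v ≡ true → at v ≡ 1
    one≡ {v} pv = cong ⟦_⟧ (trans (cong χ (decode-encode k v)) pv)
    inj : ∀ {u v} → encode k u ≡ encode k v → u ≡ v
    inj {u} {v} eq = trans (sym (decode-encode k u)) (trans (cong (decode k) eq) (decode-encode k v))

-- From restricted cuts to vertex sets.

-- Excluded middle holds under double negation, and finitely many instances can be collected there.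
-- This gives the component of a vertex a Boolean indicator without an algorithm for reachability.
¬¬-decide : ∀ {m} (P : Fin m → Set) → ¬ ¬ (∀ i → Dec (P i))
¬¬-decide {zero}  P ¬dec = ¬dec λ ()
¬¬-decide {suc m} P ¬dec = ¬¬-excluded-middle λ d₀ →
  ¬¬-decide (P ∘ suc) λ ds → ¬dec λ { zero → d₀ ; (suc i) → ds i }

¬¬-decideᵥ : ∀ k (P : Vertex k n → Set) → ¬ ¬ (∀ v → Dec (P v))
¬¬-decideᵥ k P = ¬¬-map (λ dec v → subst (Dec ∘ P) (decode-encode k v) (dec (encode k v)))
                        (¬¬-decide (P ∘ decode k))

module _ {k n : ℕ} (F : EdgeSet (DCell k n)) where
  private
    G = DCell k n

  AdjMinus-sym : ∀ {x y} → AdjMinus G F x y → AdjMinus G F y x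
  AdjMinus-sym (adj , xy∉ , yx∉) = Adj-sym k adj , yx∉ , xy∉

  Reach-trans : ∀ {x y z} → Reach G F x y → Reach G F y z → Reach G F x z
  Reach-trans r here       = r
  Reach-trans r (step s e) = step (Reach-trans r s) e

  Reach-sym : ∀ {x y} → Reach G F x y → Reach G F y x
  Reach-sym here       = here
  Reach-sym (step r e) = Reach-trans (step here (AdjMinus-sym e)) (Reach-sym r)

-- The set is the component of `u`. It has three vertices, the component of `v` supplies three
-- outside it, and all edges leaving it belong to `F`.
lower-bound : ∀ {n k} → 3 ≤ n → 3 ≤ k → (F : EdgeSet (DCell k n)) → Is3RestrictedCut (DCell k n) F →
              3 * n + 3 * k ∸ 9 ≤ size (DCell k n) F
lower-bound {n} {suc k} 3≤n 3≤k F ((u , v , ¬uv) , components) =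
  -- The goal is a decidable inequality, so its double negation suffices and reachability from `u`
  -- may be taken as decided.
  decidable-stable (_ ≤? _) (¬¬-map bound (¬¬-decideᵥ (suc k) (Reach G F u)))
  where
  G = DCell (suc k) n

  bound : (∀ w → Dec (Reach G F u w)) → 3 * n + 3 * suc k ∸ 9 ≤ size G F
  bound reach? = m≤n+o⇒m∸n≤o _ 9 (begin
    3 * n + 3 * suc k         ≡⟨ *-distribˡ-+ 3 n (suc k) ⟨
    3 * (n + suc k)           ≤⟨ restricted-edge-connectivity 3≤n k χ (s≤s⁻¹ 3≤k) 3≤#χ 3≤#¬χ ⟩
    cut (suc k) χ + 9         ≤⟨ +-monoˡ-≤ 9 (cut≤length (suc k) χ (edges F) covered) ⟩
    size G F + 9              ≡⟨ +-comm (size G F) 9 ⟩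
    9 + size G F              ∎)
    where
    open ≤-Reasoning
    χ : Vertex (suc k) n → Bool
    χ w = does (reach? w)

    reached : ∀ {w} → Reach G F u w → χ w ≡ true
    reached = dec-true (reach? _)

    unreached : ∀ {w} → Reach G F v w → not (χ w) ≡ true
    unreached vw = cong not (dec-false (reach? _) λ uw → ¬uv (Reach-trans F uw (Reach-sym F vw)))

    3≤#χ : 3 ≤ # (suc k) χ
    3≤#χ with components u
    ... | x , y , ux , uy , x≢y , x≢u , y≢u =
      three≤# (suc k) χ (reached ux) (reached uy) (reached here) x≢y x≢u y≢u

    3≤#¬χ : 3 ≤ # (suc k) (not ∘ χ)
    3≤#¬χ with components v
    ... | x , y , vx , vy , x≢y , x≢v , y≢v =
      three≤# (suc k) (not ∘ χ) (unreached vx) (unreached vy) (unreached here) x≢y x≢v y≢v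

    -- An edge listed in neither direction would survive in G - F and extend a path from `u` to `y`.
    -- List membership is decidable, so refuting its absence is enough.
    covered : ∀ x y → Adj (suc k) n x y → χ x ≡ true → χ y ≡ false → (x , y) ∈ edges F ⊎ (y , x) ∈ edges F
    covered x y adj px py = decidable-stable (((x , y) ∈? edges F) ⊎-dec ((y , x) ∈? edges F))
      λ ∉F → absurd ∉F (reach? x) (reach? y) px py
      where
      open import Data.List.Membership.DecPropositional (≡-dec (≟ᵥ {n} (suc k)) (≟ᵥ (suc k))) using (_∈?_)
      absurd : ¬ ((x , y) ∈ edges F ⊎ (y , x) ∈ edges F) →
               (dx : Dec (Reach G F u x)) (dy : Dec (Reach G F u y)) → does dx ≡ true → does dy ≢ false
      absurd ∉F (yes ux) (no ¬uy) _ _ = ¬uy (step ux (adj , ∉F ∘ inj₁ , ∉F ∘ inj₂))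

-- Upper bound: the cut around a triangle.

length-cartesianProduct : ∀ {A B : Set} (xs : List A) (ys : List B) →
                          length (cartesianProduct xs ys) ≡ length xs * length ys
length-cartesianProduct []       ys = refl
length-cartesianProduct (x ∷ xs) ys = trans (length-++ (map (x ,_) ys))
  (cong₂ _+_ (length-map (x ,_) ys) (length-cartesianProduct xs ys))

module _ (m : ℕ) where
  private
    N : ℕ
    N = 3 + m

  -- Writing n as `3 + m` splits the complete graph into the triangle `c ↑ˡ m` and the rest
  -- `3 ↑ʳ j`. All higher coordinates are zero, so the uid of a triangle vertex is `c` at every
  -- level.
  tri : ∀ k → Fin 3 → Vertex k N
  tri zero    c = c ↑ˡ m
  tri (suc k) c = zero , tri k c

  IsTri : ∀ k → Vertex k N → Set
  IsTri k v = ∃[ c ] v ≡ tri k c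

  uid-tri : ∀ k c → uid k N (tri k c) ≡ toℕ c
  uid-tri zero    c = Finₚ.toℕ-↑ˡ c m
  uid-tri (suc k) c = uid-tri k c

  tri-injective : ∀ k {c d} → tri k c ≡ tri k d → c ≡ d
  tri-injective k {c} {d} eq =
    Finₚ.toℕ-injective (trans (sym (uid-tri k c)) (trans (cong (uid k N) eq) (uid-tri k d)))

  Adj-tri : ∀ k {c d} → c ≢ d → Adj k N (tri k c) (tri k d)
  Adj-tri zero    c≢d = c≢d ∘ tri-injective 0
  Adj-tri (suc k) c≢d = inj₁ (refl , Adj-tri k c≢d)

  IsTri? : ∀ k v → Dec (IsTri k v)
  IsTri? k v = Finₚ.any? (λ c → ≟ᵥ k v (tri k c))

  -- The wiring rule with a = 0: the vertex of copy 0 with uid b - 1 is joined to the vertex of copy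
  -- b with uid 0, which is `tri k zero`.
  Adj-up : ∀ k u → Adj (suc k) N (zero , u) (suc (encode k u) , tri k zero)
  Adj-up k u = inj₂ (inj₁ (z<s , uid≡toℕ-encode k u , uid-tri k zero))

  embed : ∀ k → Vertex k N × Vertex k N → Vertex (suc k) N × Vertex (suc k) N
  embed k (u , w) = (zero , u) , (zero , w)

  spoke : ∀ k → Fin 3 → Vertex (suc k) N × Vertex (suc k) N
  spoke k c = (zero , tri k c) , (suc (encode k (tri k c)) , tri k zero)

  -- Inside the complete graph there are 3m boundary edges, and each level adds the top level edges
  -- of the three triangle vertices. Every pair starts at its triangle end.
  boundary : ∀ k → List (Vertex k N × Vertex k N)
  boundary zero    = cartesianProduct (tabulate (_↑ˡ m)) (tabulate {n = m} (3 ↑ʳ_))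
  boundary (suc k) = map (embed k) (boundary k) ++ tabulate (spoke k)

  length-boundary : ∀ k → length (boundary k) ≡ 3 * m + 3 * k
  length-boundary zero = trans
    (length-cartesianProduct (tabulate {n = 3} (_↑ˡ m)) (tabulate {n = m} (3 ↑ʳ_)))
    (trans (cong (3 *_) (length-tabulate {n = m} (3 ↑ʳ_))) (sym (+-identityʳ _)))
  length-boundary (suc k) = begin
    length (boundary (suc k))      ≡⟨ length-++ (map (embed k) (boundary k)) ⟩
    length (map (embed k) (boundary k)) + 3 ≡⟨ cong (_+ 3) (trans (length-map (embed k) (boundary k)) (length-boundary k)) ⟩
    3 * m + 3 * k + 3              ≡⟨ e m k ⟩
    3 * m + 3 * suc k              ∎
    where
    open ≡-Reasoning
    e : ∀ m k → 3 * m + 3 * k + 3 ≡ 3 * m + 3 * suc k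
    e = solve-∀

  boundary-sound : ∀ k {x y} → (x , y) ∈ boundary k → IsTri k x × ¬ IsTri k y × Adj k N x y
  boundary-sound zero xy∈
    with ∈-cartesianProduct⁻ (tabulate (_↑ˡ m)) (tabulate (3 ↑ʳ_)) xy∈
  ... | x∈ , y∈ with ∈-tabulate⁻ {f = _↑ˡ m} x∈ | ∈-tabulate⁻ {f = 3 ↑ʳ_} y∈
  ... | c , refl | j , refl = (c , refl) , (λ (d , eq) → ↑ʳ≢↑ˡ d eq) , λ eq → ↑ʳ≢↑ˡ c (sym eq)
    where
    ↑ʳ≢↑ˡ : ∀ (d : Fin 3) → 3 ↑ʳ j ≢ d ↑ˡ m
    ↑ʳ≢↑ˡ zero             ()
    ↑ʳ≢↑ˡ (suc zero)       ()
    ↑ʳ≢↑ˡ (suc (suc zero)) ()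
  boundary-sound (suc k) xy∈ with ∈-++⁻ (map (embed k) (boundary k)) xy∈
  ... | inj₁ embed∈ with ∈-map⁻ (embed k) embed∈
  ... | (u , w) , uw∈ , refl with boundary-sound k uw∈
  ... | (c , refl) , ¬tri , adj = (c , refl) , (λ (d , eq) → ¬tri (d , cong proj₂ eq)) , inj₁ (refl , adj)
  boundary-sound (suc k) xy∈ | inj₂ spoke∈ with ∈-tabulate⁻ {f = spoke k} spoke∈
  ... | c , refl = (c , refl) , (λ ()) , Adj-up k (tri k c)

  boundary-complete : ∀ k {x y} → IsTri k x → ¬ IsTri k y → Adj k N x y → (x , y) ∈ boundary k
  boundary-complete zero {y = zero}                _ ¬tri _ = contradiction (zero , refl) ¬tri
  boundary-complete zero {y = suc zero}            _ ¬tri _ = contradiction (suc zero , refl) ¬tri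
  boundary-complete zero {y = suc (suc zero)}      _ ¬tri _ = contradiction (suc (suc zero) , refl) ¬tri
  boundary-complete zero {y = suc (suc (suc j))}   (c , refl) _ _ =
    ∈-cartesianProduct⁺ (∈-tabulate⁺ {f = _↑ˡ m} c) (∈-tabulate⁺ {f = 3 ↑ʳ_} j)
  boundary-complete (suc k) (c , refl) ¬tri (inj₁ (refl , adj)) =
    ∈-++⁺ˡ (∈-map⁺ (embed k) (boundary-complete k (c , refl) (λ (d , eq) → ¬tri (d , cong (zero ,_) eq)) adj))
  -- Copy 0 has the smallest index, so only this order of the copies occurs. The two uid equations
  -- determine the copy and the vertex of the other end, which make the edge a `spoke`.
  boundary-complete (suc k) {y = suc j , w} (c , refl) ¬tri (inj₂ (inj₁ (_ , uid-x , uid-w))) =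
    subst (λ y → ((zero , tri k c) , y) ∈ boundary (suc k))
      (cong₂ (λ i v → suc i , v)
        (Finₚ.toℕ-injective (trans (sym (uid≡toℕ-encode k (tri k c))) uid-x))
        (uid-injective k (trans (uid-tri k zero) (sym uid-w))))
      (∈-++⁺ʳ (map (embed k) (boundary k)) (∈-tabulate⁺ {f = spoke k} c))

  boundary-unique : ∀ k → Unique (boundary k)
  boundary-unique zero = Uniqueₚ.cartesianProduct⁺
    (Uniqueₚ.tabulate⁺ (Finₚ.↑ˡ-injective m _ _)) (Uniqueₚ.tabulate⁺ (Finₚ.↑ʳ-injective 3 _ _))
  boundary-unique (suc k) = Uniqueₚ.++⁺
    (Uniqueₚ.map⁺ (λ { refl → refl }) (boundary-unique k))
    (Uniqueₚ.tabulate⁺ {f = spoke k} (tri-injective k ∘ cong (proj₂ ∘ proj₁)))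
    λ { (e∈ , e∈′) → disjoint (∈-map⁻ (embed k) e∈) (∈-tabulate⁻ {f = spoke k} e∈′) }
    where
    disjoint : ∀ {e} → (∃[ uw ] (uw ∈ boundary k × e ≡ embed k uw)) → ¬ (∃[ c ] e ≡ spoke k c)
    disjoint (_ , _ , refl) (_ , ())

  two-neighbours : ∀ k (u : Vertex k N) → ∃[ x ] ∃[ y ] (Adj k N u x × Adj k N u y × x ≢ y × x ≢ u × y ≢ u)
  two-neighbours zero zero          = suc zero , suc (suc zero) , (λ ()) , (λ ()) , (λ ()) , (λ ()) , λ ()
  two-neighbours zero (suc zero)    = zero , suc (suc zero) , (λ ()) , (λ ()) , (λ ()) , (λ ()) , λ ()
  two-neighbours zero (suc (suc _)) = zero , suc zero , (λ ()) , (λ ()) , (λ ()) , (λ ()) , λ ()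
  two-neighbours (suc k) (i , u) with two-neighbours k u
  ... | x , y , ux , uy , x≢y , x≢u , y≢u = (i , x) , (i , y) , inj₁ (refl , ux) , inj₁ (refl , uy) ,
    x≢y ∘ cong proj₂ , x≢u ∘ cong proj₂ , y≢u ∘ cong proj₂

  module _ (k : ℕ) where
    private
      G = DCell (suc k) N

      -- All pairs start in the triangle and end outside it, so none is the reverse of another and
      -- distinctness as ordered pairs is enough.
      distinct-edges : ∀ {es} → All (λ (x , y) → IsTri (suc k) x × ¬ IsTri (suc k) y) es → Unique es →
                       AllPairs (λ e f → ¬ SameEdge G e f) es
      distinct-edges []               []       = []
      distinct-edges ((tx , _) ∷ oes) (e∉ ∷ u) =
        All.zipWith (λ { (_ , _ , ¬ty) (inj₂ (refl , _)) → ¬ty tx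
                       ; (e≢ , _)      (inj₁ (refl , refl)) → e≢ refl }) (e∉ , oes)
        ∷ distinct-edges oes u

    triangle-cut : EdgeSet G
    triangle-cut = record
      { edges    = boundary (suc k)
      ; areEdges = λ e∈ → proj₂ (proj₂ (boundary-sound (suc k) e∈))
      ; distinct = distinct-edges
          (All.tabulate λ e∈ → let (tx , ¬ty , _) = boundary-sound (suc k) e∈ in tx , ¬ty)
          (boundary-unique (suc k))
      }

    private
      keep-inside : ∀ {x y} → IsTri (suc k) x → IsTri (suc k) y → Adj (suc k) N x y →
                    AdjMinus G triangle-cut x y
      keep-inside tx ty adj = adj , (λ e∈ → proj₁ (proj₂ (boundary-sound (suc k) e∈)) ty)
                                  , (λ e∈ → proj₁ (proj₂ (boundary-sound (suc k) e∈)) tx)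

      keep-outside : ∀ {x y} → ¬ IsTri (suc k) x → ¬ IsTri (suc k) y → Adj (suc k) N x y →
                     AdjMinus G triangle-cut x y
      keep-outside ¬tx ¬ty adj = adj , ¬tx ∘ proj₁ ∘ boundary-sound (suc k)
                                     , ¬ty ∘ proj₁ ∘ boundary-sound (suc k)

      -- By `boundary-complete`, a path leaving the triangle would have to use a removed edge.
      Reach-tri : ∀ {x y} → Reach G triangle-cut x y → IsTri (suc k) x → IsTri (suc k) y
      Reach-tri here tx = tx
      Reach-tri (step {v} {w} r (adj , vw∉ , _)) tx with IsTri? (suc k) w
      ... | yes tw = tw
      ... | no ¬tw = contradiction (boundary-complete (suc k) (Reach-tri r tx) ¬tw adj) vw∉

      others : ∀ (c : Fin 3) → ∃[ d ] ∃[ e ] (c ≢ d × c ≢ e × d ≢ e)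
      others zero             = suc zero , suc (suc zero) , (λ ()) , (λ ()) , λ ()
      others (suc zero)       = zero , suc (suc zero) , (λ ()) , (λ ()) , λ ()
      others (suc (suc zero)) = zero , suc zero , (λ ()) , (λ ()) , λ ()

      ¬tri-suc : ∀ {i : Fin (t k N)} {u} → ¬ IsTri (suc k) (suc i , u)
      ¬tri-suc ()

      large-components : ∀ v → ∃[ x ] ∃[ y ]
        (Reach G triangle-cut v x × Reach G triangle-cut v y × x ≢ y × x ≢ v × y ≢ v)
      large-components v with IsTri? (suc k) v
      ... | yes (c , refl) with others c
      ... | d , e , c≢d , c≢e , d≢e = tri (suc k) d , tri (suc k) e ,
        step here (keep-inside (c , refl) (d , refl) (Adj-tri (suc k) c≢d)) ,
        step here (keep-inside (c , refl) (e , refl) (Adj-tri (suc k) c≢e)) ,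
        d≢e ∘ tri-injective (suc k) , c≢d ∘ sym ∘ tri-injective (suc k) , c≢e ∘ sym ∘ tri-injective (suc k)
      -- Outside copy 0 there are no triangle vertices, so all edges within the copy survive.
      large-components (suc i , u) | no ¬tv with two-neighbours k u
      ... | x , y , ux , uy , x≢y , x≢u , y≢u = (suc i , x) , (suc i , y) ,
        step here (keep-outside ¬tri-suc ¬tri-suc (inj₁ (refl , ux))) ,
        step here (keep-outside ¬tri-suc ¬tri-suc (inj₁ (refl , uy))) ,
        x≢y ∘ cong proj₂ , x≢u ∘ cong proj₂ , y≢u ∘ cong proj₂
      -- Here all neighbours in the same complete graph may be triangle vertices, as for n = 4. The
      -- top level edge leads out of copy 0 and survives, and a further step inside the new copy
      -- gives the third vertex.
      large-components (zero , u) | no ¬tv with two-neighbours k (tri k zero)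
      ... | y , _ , zy , _ , _ , y≢z , _ =
        (suc (encode k u) , tri k zero) , (suc (encode k u) , y) ,
        up ,
        step up (keep-outside ¬tri-suc ¬tri-suc (inj₁ (refl , zy))) ,
        y≢z ∘ sym ∘ cong proj₂ , (λ ()) , λ ()
        where
        up : Reach G triangle-cut (zero , u) (suc (encode k u) , tri k zero)
        up = step here (keep-outside ¬tv ¬tri-suc (Adj-up k u))

    triangle-cut-restricted : Is3RestrictedCut G triangle-cut
    triangle-cut-restricted =
      (tri (suc k) zero , (suc (encode k (tri k zero)) , tri k zero) , λ r → ¬tri-suc (Reach-tri r (zero , refl))) ,
      large-components


theorem10 : ∀ (n k : ℕ) → 3 ≤ n → 3 ≤ k → Lambda3≡ (DCell k n) (3 * n + 3 * k ∸ 9)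
theorem10 n k@(suc k′) 3≤n 3≤k with m≤n⇒∃[o]m+o≡n 3≤n
... | m , refl = (triangle-cut m k′ , triangle-cut-restricted m k′ , trans (length-boundary m k) count) ,
                 lower-bound 3≤n 3≤k
  where
  e : ∀ m k → 3 * (3 + m) + 3 * k ≡ 9 + (3 * m + 3 * k)
  e = solve-∀
  count : 3 * m + 3 * k ≡ 3 * (3 + m) + 3 * k ∸ 9
  count = sym (cong (_∸ 9) (e m k))
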